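{- Let $\mathbb{F}_q$ be a finite field with $q\equiv -1\pmod 3$. Then every elliptic curve over $\mathbb{F}_q$ with an $\mathbb{F}_q$-rational point of order $3$ is isomorphic over $\mathbb{F}_q$ to a curve with equation $y^2+axy+y=x^3$ with $a\in\mathbb{F}_q$, $a\neq 3$. Moreover, for such a curve the group $E(\mathbb{F}_q)[3]$ of $\mathbb{F}_q$-rational $3$-torsion points is cyclic. -}

module Defs where

open import Level using (Level; _⊔_) renaming (suc to lsuc)
open import Algebra.Bundles using (CommutativeRing; RawGroup)
import Algebra.Definitions
import Algebra.Definitions.RawMonoid
import Algebra.Properties.AbelianGroup
import Algebra.Properties.Ring
import Algebra.Properties.Semiring.Exp
import Algebra.Properties.Semiring.Mult.TCOptimised
import Algebra.Solver.Ring
import Algebra.Solver.Ring.AlmostCommutativeRing as ACR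
open import Data.Fin.Base using (Fin)
import Data.Fin.Properties as Fin
open import Data.Integer.Base as ℤ using (ℤ; +_; -[1+_])
import Data.Integer.Properties as ℤ
open import Data.Maybe.Base using (Maybe; just; nothing)
open import Data.Nat.Base as ℕ using (ℕ; zero; suc)
open import Data.Product.Base using (∃-syntax; _×_; _,_; proj₁; proj₂)
open import Function.Bundles using (Inverse)
open import Function.Properties.Inverse using (Inverse⇒Injection)
open import Relation.Binary.Definitions using (Decidable)
open import Relation.Binary.PropositionalEquality.Core as ≡ using (_≡_)
import Relation.Binary.PropositionalEquality.Properties as ≡
import Relation.Binary.Reasoning.Setoid
open import Relation.Nullary.Decidable using (yes; no; via-injection)
open import Relation.Nullary.Negation using (¬_; contradiction)
open import Relation.Unary using (Pred)

private
  variable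
    c ℓ p : Level

module IntegerSolver (R : CommutativeRing c ℓ) where

  open CommutativeRing R
  open Algebra.Properties.Ring ring using (-‿distribˡ-*; -‿distribʳ-*)
  open Algebra.Properties.AbelianGroup +-abelianGroup
    using (⁻¹-∙-comm; ⁻¹-involutive; ε⁻¹≈ε; xyx⁻¹≈y)
  open Algebra.Properties.Semiring.Mult.TCOptimised semiring
    using (1+×; ×-homo-+; ×1-homo-*) renaming (_×_ to _·_)
  open Relation.Binary.Reasoning.Setoid setoid

  fromℕ : ℕ → Carrier
  fromℕ n = n · 1#

  fromℤ : ℤ → Carrier
  fromℤ (+ n)    = fromℕ n
  fromℤ -[1+ n ] = - fromℕ (suc n)

  fromℤ-neg : ∀ i → fromℤ (ℤ.- i) ≈ - fromℤ i
  fromℤ-neg (+ zero)    = sym ε⁻¹≈ε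
  fromℤ-neg (+ (suc n)) = refl
  fromℤ-neg -[1+ n ]    = sym (⁻¹-involutive _)

  fromℤ-⊖ : ∀ m n → fromℤ (m ℤ.⊖ n) ≈ fromℕ m + - fromℕ n
  fromℤ-⊖ zero    zero    = sym (-‿inverseʳ 0#)
  fromℤ-⊖ zero    (suc n) = sym (+-identityˡ _)
  fromℤ-⊖ (suc m) zero    = sym (trans (+-congˡ ε⁻¹≈ε) (+-identityʳ _))
  fromℤ-⊖ (suc m) (suc n) = begin
    fromℤ (suc m ℤ.⊖ suc n)                ≡⟨ ≡.cong fromℤ (ℤ.[1+m]⊖[1+n]≡m⊖n m n) ⟩
    fromℤ (m ℤ.⊖ n)                        ≈⟨ fromℤ-⊖ m n ⟩
    fromℕ m + - fromℕ n                    ≈⟨ +-congʳ (xyx⁻¹≈y 1# (fromℕ m)) ⟨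
    1# + fromℕ m + - 1# + - fromℕ n        ≈⟨ +-assoc _ _ _ ⟩
    1# + fromℕ m + (- 1# + - fromℕ n)      ≈⟨ +-congˡ (⁻¹-∙-comm 1# (fromℕ n)) ⟩
    1# + fromℕ m + - (1# + fromℕ n)        ≈⟨ +-cong (1+× m 1#) (-‿cong (1+× n 1#)) ⟨
    fromℕ (suc m) + - fromℕ (suc n)        ∎

  fromℤ-+ : ∀ i j → fromℤ (i ℤ.+ j) ≈ fromℤ i + fromℤ j
  fromℤ-+ (+ m)    (+ n)    = ×-homo-+ 1# m n
  fromℤ-+ (+ m)    -[1+ n ] = fromℤ-⊖ m (suc n)
  fromℤ-+ -[1+ m ] (+ n)    = trans (fromℤ-⊖ n (suc m)) (+-comm _ _)
  fromℤ-+ -[1+ m ] -[1+ n ] = begin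
    fromℤ (-[1+ m ] ℤ.+ -[1+ n ])               ≡⟨ ≡.cong fromℤ (ℤ.neg-distrib-+ (+ suc m) (+ suc n)) ⟨
    fromℤ (ℤ.- (+ (suc m ℕ.+ suc n)))           ≈⟨ -‿cong (×-homo-+ 1# (suc m) (suc n)) ⟩
    - (fromℕ (suc m) + fromℕ (suc n))           ≈⟨ ⁻¹-∙-comm _ _ ⟨
    - fromℕ (suc m) + - fromℕ (suc n)           ∎

  fromℤ-*-pos : ∀ m j → fromℤ (+ m ℤ.* j) ≈ fromℕ m * fromℤ j
  fromℤ-*-pos m (+ n)    = begin
    fromℤ (+ m ℤ.* + n)  ≡⟨ ≡.cong fromℤ (ℤ.pos-* m n) ⟨
    fromℕ (m ℕ.* n)      ≈⟨ ×1-homo-* m n ⟩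
    fromℕ m * fromℕ n    ∎
  fromℤ-*-pos m -[1+ n ] = begin
    fromℤ (+ m ℤ.* -[1+ n ])         ≡⟨ ≡.cong fromℤ (ℤ.neg-distribʳ-* (+ m) (+ suc n)) ⟨
    fromℤ (ℤ.- (+ m ℤ.* + suc n))    ≈⟨ fromℤ-neg (+ m ℤ.* + suc n) ⟩
    - fromℤ (+ m ℤ.* + suc n)        ≈⟨ -‿cong (fromℤ-*-pos m (+ suc n)) ⟩
    - (fromℕ m * fromℕ (suc n))      ≈⟨ -‿distribʳ-* _ _ ⟩
    fromℕ m * - fromℕ (suc n)        ∎

  fromℤ-* : ∀ i j → fromℤ (i ℤ.* j) ≈ fromℤ i * fromℤ j
  fromℤ-* (+ m)    j = fromℤ-*-pos m j
  fromℤ-* -[1+ m ] j = begin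
    fromℤ (-[1+ m ] ℤ.* j)           ≡⟨ ≡.cong fromℤ (ℤ.neg-distribˡ-* (+ suc m) j) ⟨
    fromℤ (ℤ.- (+ suc m ℤ.* j))      ≈⟨ fromℤ-neg (+ suc m ℤ.* j) ⟩
    - fromℤ (+ suc m ℤ.* j)          ≈⟨ -‿cong (fromℤ-*-pos (suc m) j) ⟩
    - (fromℕ (suc m) * fromℤ j)      ≈⟨ -‿distribˡ-* _ _ ⟩
    - fromℕ (suc m) * fromℤ j        ∎

  almostCommutativeRing : ACR.AlmostCommutativeRing c ℓ
  almostCommutativeRing = ACR.fromCommutativeRing R

  fromℤ-morphism :
    ℤ.+-*-rawRing ACR.-Raw-AlmostCommutative⟶ almostCommutativeRing
  fromℤ-morphism = record
    { ⟦_⟧    = fromℤ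
    ; +-homo = fromℤ-+
    ; *-homo = fromℤ-*
    ; -‿homo = fromℤ-neg
    ; 0-homo = refl
    ; 1-homo = refl
    }

  fromℤ-≟ : ∀ i j → Maybe (fromℤ i ≈ fromℤ j)
  fromℤ-≟ i j with i ℤ.≟ j
  ... | yes i≡j = just (reflexive (≡.cong fromℤ i≡j))
  ... | no  _   = nothing

  open Algebra.Solver.Ring ℤ.+-*-rawRing almostCommutativeRing
    fromℤ-morphism fromℤ-≟ public
    using (solve; _:=_; con; _:+_; _:*_; _:-_; :-_; _:^_)

record FiniteField c ℓ : Set (lsuc (c ⊔ ℓ)) where
  field
    commutativeRing : CommutativeRing c ℓ

  open CommutativeRing commutativeRing public
  open Algebra.Definitions _≈_ using (Invertible)

  field
    1≉0         : 1# ≉ 0#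
    invertible  : ∀ {x} → x ≉ 0# → Invertible 1# _*_ x
    order       : ℕ
    enumeration : Inverse setoid (≡.setoid (Fin order))

  infix 4 _≟_
  _≟_ : Decidable _≈_
  _≟_ = via-injection (Inverse⇒Injection enumeration) Fin._≟_

  inv : ∀ x → x ≉ 0# → Carrier
  inv x x≉0 = proj₁ (invertible x≉0)

  inv-inverseˡ : ∀ {x} (x≉0 : x ≉ 0#) → inv x x≉0 * x ≈ 1#
  inv-inverseˡ x≉0 = proj₁ (proj₂ (invertible x≉0))

  *-cancelˡ-0 : ∀ {x y} → x ≉ 0# → x * y ≈ 0# → y ≈ 0#
  *-cancelˡ-0 {x} {y} x≉0 xy≈0 = begin
    y                       ≈⟨ *-identityˡ y ⟨
    1# * y                  ≈⟨ *-congʳ (inv-inverseˡ x≉0) ⟨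
    inv x x≉0 * x * y       ≈⟨ *-assoc _ _ _ ⟩
    inv x x≉0 * (x * y)     ≈⟨ *-congˡ xy≈0 ⟩
    inv x x≉0 * 0#          ≈⟨ zeroʳ _ ⟩
    0#                      ∎
    where open Relation.Binary.Reasoning.Setoid setoid

-- These notions involve only the operations of a group, not its axioms.
-- n-fold multiples are written additively.

module GroupNotions (G : RawGroup c ℓ) where

  open RawGroup G
  open Algebra.Definitions.RawMonoid rawMonoid using () renaming (_×_ to _·_)

  infixr 8 _·ℤ_
  _·ℤ_ : ℤ → Carrier → Carrier
  (+ n)    ·ℤ x = n · x
  -[1+ n ] ·ℤ x = (suc n · x) ⁻¹

  Torsion : ℕ → Pred Carrier ℓ
  Torsion n x = n · x ≈ ε

  HasOrder : ℕ → Pred Carrier ℓ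
  HasOrder n x =
    0 ℕ.< n × n · x ≈ ε × (∀ m → 0 ℕ.< m → m ℕ.< n → ¬ (m · x ≈ ε))

  IsCyclic : Pred Carrier p → Set _
  IsCyclic S = ∃[ g ] S g × (∀ x → S x → ∃[ k ] x ≈ k ·ℤ g)

module EllipticCurves (F : FiniteField c ℓ) where

  open FiniteField F
  open IntegerSolver commutativeRing
  open Algebra.Properties.Semiring.Exp semiring using (_^_; ^-congˡ)
  open Algebra.Properties.AbelianGroup +-abelianGroup
    using (x≈y⇒x∙y⁻¹≈ε; x∙y⁻¹≈ε⇒x≈y)
  private module ≈-Reasoning = Relation.Binary.Reasoning.Setoid setoid

  record WeierstrassCurve : Set c where
    constructor weierstrass
    field
      a₁ a₂ a₃ a₄ a₆ : Carrier

    b₂ b₄ b₆ b₈ Δ : Carrier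
    b₂ = a₁ ^ 2 + fromℕ 4 * a₂
    b₄ = fromℕ 2 * a₄ + a₁ * a₃
    b₆ = a₃ ^ 2 + fromℕ 4 * a₆
    b₈ = a₁ ^ 2 * a₆ + fromℕ 4 * a₂ * a₆ - a₁ * a₃ * a₄ + a₂ * a₃ ^ 2 - a₄ ^ 2
    Δ  = - (b₂ ^ 2 * b₈) - fromℕ 8 * b₄ ^ 3 - fromℕ 27 * b₆ ^ 2
         + fromℕ 9 * b₂ * b₄ * b₆

    OnCurve : Carrier → Carrier → Set ℓ
    OnCurve x y =
      y ^ 2 + a₁ * x * y + a₃ * y ≈ x ^ 3 + a₂ * x ^ 2 + a₄ * x + a₆

  record EllipticCurve : Set (c ⊔ ℓ) where
    constructor elliptic
    field
      curve       : WeierstrassCurve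
      nonsingular : WeierstrassCurve.Δ curve ≉ 0#

    open WeierstrassCurve curve public

  infix 4 _≅_

  -- W ≅ W′: an F-rational admissible change of variables
  --   x = u² x′ + r,   y = u³ y′ + u² s x′ + t
  -- turns the equation of W into u⁶ times the equation of W′.  The
  -- isomorphisms over F between elliptic curves in Weierstrass form that
  -- preserve the point at infinity are exactly these.
  record _≅_ (W W′ : WeierstrassCurve) : Set (c ⊔ ℓ) where
    private
      module W  = WeierstrassCurve W
      module W′ = WeierstrassCurve W′
    field
      u r s t : Carrier
      u≉0     : u ≉ 0#
      a₁-eq   : u * W′.a₁ ≈ W.a₁ + fromℕ 2 * s
      a₂-eq   : u ^ 2 * W′.a₂ ≈ W.a₂ - s * W.a₁ + fromℕ 3 * r - s ^ 2
      a₃-eq   : u ^ 3 * W′.a₃ ≈ W.a₃ + r * W.a₁ + fromℕ 2 * t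
      a₄-eq   : u ^ 4 * W′.a₄ ≈ W.a₄ - s * W.a₃ + fromℕ 2 * r * W.a₂
                                - (t + r * s) * W.a₁ + fromℕ 3 * r ^ 2
                                - fromℕ 2 * s * t
      a₆-eq   : u ^ 6 * W′.a₆ ≈ W.a₆ + r * W.a₄ + r ^ 2 * W.a₂ + r ^ 3
                                - t * W.a₃ - t ^ 2 - r * t * W.a₁

  cubic : (b c d x : Carrier) → Carrier
  cubic b c d x = x ^ 3 + b * x ^ 2 + c * x + d

  cubic-third-root : ∀ b c d x₁ x₂ → x₁ - x₂ ≉ 0# →
    cubic b c d x₁ ≈ 0# → cubic b c d x₂ ≈ 0# → cubic b c d (- b - x₁ - x₂) ≈ 0#
  cubic-third-root b c d x₁ x₂ x₁≉x₂ g₁≈0 g₂≈0 = *-cancelˡ-0 x₁≉x₂ (begin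
    (x₁ - x₂) * cubic b c d x₃
      ≈⟨ solve 5 (λ b c d x₁ x₂ →
           let g  = λ x → x :^ 3 :+ b :* x :^ 2 :+ c :* x :+ d
               x₃ = :- b :- x₁ :- x₂
           in (x₁ :- x₂) :* g x₃ := (x₃ :- x₂) :* g x₁ :- (x₃ :- x₁) :* g x₂)
         refl b c d x₁ x₂ ⟩
    (x₃ - x₂) * cubic b c d x₁ - (x₃ - x₁) * cubic b c d x₂
      ≈⟨ +-cong (*-congˡ g₁≈0) (-‿cong (*-congˡ g₂≈0)) ⟩
    (x₃ - x₂) * 0# - (x₃ - x₁) * 0#
      ≈⟨ solve 2 (λ p q → p :* con (+ 0) :- q :* con (+ 0) := con (+ 0))
         refl (x₃ - x₂) (x₃ - x₁) ⟩
    0# ∎)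
    where
    open ≈-Reasoning
    x₃ = - b - x₁ - x₂

  cubic-double-root : ∀ b c d x₁ → cubic b c d x₁ ≈ 0# →
    fromℕ 3 * x₁ ^ 2 + fromℕ 2 * b * x₁ + c ≈ 0# →
    cubic b c d (- b - x₁ - x₁) ≈ 0#
  cubic-double-root b c d x₁ g≈0 g′≈0 = begin
    cubic b c d x₃
      ≈⟨ solve 4 (λ b c d x₁ →
           let g  = λ x → x :^ 3 :+ b :* x :^ 2 :+ c :* x :+ d
               x₃ = :- b :- x₁ :- x₁
           in g x₃ := g x₁ :+ (x₃ :- x₁) :*
                (con (+ 3) :* x₁ :^ 2 :+ con (+ 2) :* b :* x₁ :+ c))
         refl b c d x₁ ⟩
    cubic b c d x₁ + (x₃ - x₁) * (fromℕ 3 * x₁ ^ 2 + fromℕ 2 * b * x₁ + c)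
      ≈⟨ +-cong g≈0 (*-congˡ g′≈0) ⟩
    0# + (x₃ - x₁) * 0#
      ≈⟨ trans (+-identityˡ _) (zeroʳ _) ⟩
    0# ∎
    where
    open ≈-Reasoning
    x₃ = - b - x₁ - x₁

  module Points (W : WeierstrassCurve) where

    open WeierstrassCurve W

    data Point : Set (c ⊔ ℓ) where
      𝒪      : Point
      affine : ∀ x y → OnCurve x y → Point

    infix 4 _≈ₚ_
    data _≈ₚ_ : Point → Point → Set (c ⊔ ℓ) where
      𝒪≈𝒪         : 𝒪 ≈ₚ 𝒪
      affine≈affine : ∀ {x x′ y y′ e e′} → x ≈ x′ → y ≈ y′ →
                      affine x y e ≈ₚ affine x′ y′ e′

    negY : Carrier → Carrier → Carrier
    negY x y = - y - a₁ * x - a₃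

    line : (m x₁ y₁ x : Carrier) → Carrier
    line m x₁ y₁ x = m * (x - x₁) + y₁

    thirdX : (m x₁ x₂ : Carrier) → Carrier
    thirdX m x₁ x₂ = m ^ 2 + a₁ * m - a₂ - x₁ - x₂

    tangentNum : Carrier → Carrier → Carrier
    tangentNum x y = fromℕ 3 * x ^ 2 + fromℕ 2 * a₂ * x + a₄ - a₁ * y

    tangentDen : Carrier → Carrier → Carrier
    tangentDen x y = fromℕ 2 * y + a₁ * x + a₃

    -- Substituting y = line m x₁ y₁ x in the equation of the curve gives
    -- the cubic x³ + lineB m x² + lineC m x₁ y₁ x + lineD m x₁ y₁ = 0.
    lineB : Carrier → Carrier
    lineB m = a₂ - m ^ 2 - a₁ * m

    lineC lineD : (m x₁ y₁ : Carrier) → Carrier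
    lineC m x₁ y₁ = a₄ - fromℕ 2 * m * (y₁ - m * x₁) - a₁ * (y₁ - m * x₁) - a₃ * m
    lineD m x₁ y₁ = a₆ - (y₁ - m * x₁) ^ 2 - a₃ * (y₁ - m * x₁)

    lineCubic : (m x₁ y₁ x : Carrier) → Carrier
    lineCubic m x₁ y₁ = cubic (lineB m) (lineC m x₁ y₁) (lineD m x₁ y₁)

    lineCubic-eq : ∀ m x₁ y₁ x → let y = line m x₁ y₁ x in
      lineCubic m x₁ y₁ x ≈
      x ^ 3 + a₂ * x ^ 2 + a₄ * x + a₆ - (y ^ 2 + a₁ * x * y + a₃ * y)
    lineCubic-eq m x₁ y₁ x = solve 9 (λ a₁ a₂ a₃ a₄ a₆ m x₁ y₁ x →
      let n = y₁ :- m :* x₁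
          y = m :* (x :- x₁) :+ y₁
      in x :^ 3 :+ (a₂ :- m :^ 2 :- a₁ :* m) :* x :^ 2
         :+ (a₄ :- con (+ 2) :* m :* n :- a₁ :* n :- a₃ :* m) :* x
         :+ (a₆ :- n :^ 2 :- a₃ :* n)
         := x :^ 3 :+ a₂ :* x :^ 2 :+ a₄ :* x :+ a₆
            :- (y :^ 2 :+ a₁ :* x :* y :+ a₃ :* y))
      refl a₁ a₂ a₃ a₄ a₆ m x₁ y₁ x

    OnCurve-resp : ∀ {x x′ y y′} → x ≈ x′ → y ≈ y′ → OnCurve x y → OnCurve x′ y′
    OnCurve-resp {x} {x′} {y} {y′} x≈ y≈ e = begin
      y′ ^ 2 + a₁ * x′ * y′ + a₃ * y′
        ≈⟨ +-cong (+-cong (^-congˡ 2 y≈) (*-cong (*-congˡ x≈) y≈)) (*-congˡ y≈) ⟨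
      y ^ 2 + a₁ * x * y + a₃ * y
        ≈⟨ e ⟩
      x ^ 3 + a₂ * x ^ 2 + a₄ * x + a₆
        ≈⟨ +-congʳ (+-cong (+-cong (^-congˡ 3 x≈) (*-congˡ (^-congˡ 2 x≈))) (*-congˡ x≈)) ⟩
      x′ ^ 3 + a₂ * x′ ^ 2 + a₄ * x′ + a₆ ∎
      where open ≈-Reasoning

    onCurve⇒lineCubic : ∀ m x₁ y₁ x →
      OnCurve x (line m x₁ y₁ x) → lineCubic m x₁ y₁ x ≈ 0#
    onCurve⇒lineCubic m x₁ y₁ x e =
      trans (lineCubic-eq m x₁ y₁ x) (x≈y⇒x∙y⁻¹≈ε (sym e))

    lineCubic⇒onCurve : ∀ m x₁ y₁ x →
      lineCubic m x₁ y₁ x ≈ 0# → OnCurve x (line m x₁ y₁ x)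
    lineCubic⇒onCurve m x₁ y₁ x g≈0 =
      sym (x∙y⁻¹≈ε⇒x≈y _ _ (trans (sym (lineCubic-eq m x₁ y₁ x)) g≈0))

    line-start : ∀ m x y → line m x y x ≈ y
    line-start m x y =
      solve 3 (λ m x y → m :* (x :- x) :+ y := y) refl m x y

    thirdX-eq : ∀ m x₁ x₂ → - lineB m - x₁ - x₂ ≈ thirdX m x₁ x₂
    thirdX-eq m x₁ x₂ = solve 5 (λ a₁ a₂ m x₁ x₂ →
      :- (a₂ :- m :^ 2 :- a₁ :* m) :- x₁ :- x₂
      := m :^ 2 :+ a₁ :* m :- a₂ :- x₁ :- x₂) refl a₁ a₂ m x₁ x₂

    third-onCurve : ∀ m x₁ y₁ x₂ → lineCubic m x₁ y₁ (- lineB m - x₁ - x₂) ≈ 0# →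
      OnCurve (thirdX m x₁ x₂) (line m x₁ y₁ (thirdX m x₁ x₂))
    third-onCurve m x₁ y₁ x₂ g≈0 =
      OnCurve-resp eq (+-congʳ (*-congˡ (+-congʳ eq)))
        (lineCubic⇒onCurve m x₁ y₁ _ g≈0)
      where eq = thirdX-eq m x₁ x₂

    chord-onCurve : ∀ {m x₁ y₁ x₂ y₂} → OnCurve x₁ y₁ → OnCurve x₂ y₂ →
      x₁ - x₂ ≉ 0# → m * (x₁ - x₂) ≈ y₁ - y₂ →
      OnCurve (thirdX m x₁ x₂) (line m x₁ y₁ (thirdX m x₁ x₂))
    chord-onCurve {m} {x₁} {y₁} {x₂} {y₂} e₁ e₂ x₁≉x₂ slope =
      third-onCurve m x₁ y₁ x₂ (cubic-third-root _ _ _ _ _ x₁≉x₂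
        (onCurve⇒lineCubic m x₁ y₁ x₁ (OnCurve-resp refl (sym (line-start m x₁ y₁)) e₁))
        (onCurve⇒lineCubic m x₁ y₁ x₂ (OnCurve-resp refl (sym end) e₂)))
      where
      open ≈-Reasoning
      end : line m x₁ y₁ x₂ ≈ y₂
      end = begin
        m * (x₂ - x₁) + y₁
          ≈⟨ solve 4 (λ m x₁ x₂ y₁ →
               m :* (x₂ :- x₁) :+ y₁ := y₁ :- m :* (x₁ :- x₂)) refl m x₁ x₂ y₁ ⟩
        y₁ - m * (x₁ - x₂)
          ≈⟨ +-congˡ (-‿cong slope) ⟩
        y₁ - (y₁ - y₂)
          ≈⟨ solve 2 (λ y₁ y₂ → y₁ :- (y₁ :- y₂) := y₂) refl y₁ y₂ ⟩
        y₂ ∎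

    tangent-onCurve : ∀ {m x₁ y₁ x₂} → OnCurve x₁ y₁ → x₁ ≈ x₂ →
      m * tangentDen x₁ y₁ ≈ tangentNum x₁ y₁ →
      OnCurve (thirdX m x₁ x₂) (line m x₁ y₁ (thirdX m x₁ x₂))
    tangent-onCurve {m} {x₁} {y₁} {x₂} e₁ x₁≈x₂ slope =
      OnCurve-resp eq (+-congʳ (*-congˡ (+-congʳ eq)))
        (third-onCurve m x₁ y₁ x₁ (cubic-double-root _ _ _ _
          (onCurve⇒lineCubic m x₁ y₁ x₁ (OnCurve-resp refl (sym (line-start m x₁ y₁)) e₁))
          (trans
            (solve 7 (λ a₁ a₂ a₃ a₄ m x₁ y₁ →
              let n = y₁ :- m :* x₁ in
              con (+ 3) :* x₁ :^ 2 :+ con (+ 2) :* (a₂ :- m :^ 2 :- a₁ :* m) :* x₁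
              :+ (a₄ :- con (+ 2) :* m :* n :- a₁ :* n :- a₃ :* m)
              := con (+ 3) :* x₁ :^ 2 :+ con (+ 2) :* a₂ :* x₁ :+ a₄ :- a₁ :* y₁
                 :- m :* (con (+ 2) :* y₁ :+ a₁ :* x₁ :+ a₃))
              refl a₁ a₂ a₃ a₄ m x₁ y₁)
            (x≈y⇒x∙y⁻¹≈ε (sym slope)))))
      where
      eq : thirdX m x₁ x₁ ≈ thirdX m x₁ x₂
      eq = +-congˡ (-‿cong x₁≈x₂)

    negY-onCurve : ∀ {x y} → OnCurve x y → OnCurve x (negY x y)
    negY-onCurve {x} {y} e = trans
      (solve 4 (λ a₁ a₃ x y →
        let y′ = :- y :- a₁ :* x :- a₃ in
        y′ :^ 2 :+ a₁ :* x :* y′ :+ a₃ :* y′ := y :^ 2 :+ a₁ :* x :* y :+ a₃ :* y)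
        refl a₁ a₃ x y)
      e

    -- On a vertical line there are only the points with y = y₂ and
    -- y = negY x₂ y₂, and the tangent at a point is vertical only if
    -- y₁ = negY x₁ y₁.
    tangentDen≉0 : ∀ {x₁ y₁ x₂ y₂} → OnCurve x₁ y₁ → OnCurve x₂ y₂ →
      x₁ ≈ x₂ → y₁ ≉ negY x₂ y₂ → tangentDen x₁ y₁ ≉ 0#
    tangentDen≉0 {x₁} {y₁} {x₂} {y₂} e₁ e₂ x₁≈x₂ y₁≉-y₂ den≈0 =
      y₁≉-y₂ (x∙y⁻¹≈ε⇒x≈y _ _ (begin
        y₁ - negY x₂ y₂
          ≈⟨ solve 5 (λ a₁ a₃ x₂ y₁ y₂ →
               y₁ :- (:- y₂ :- a₁ :* x₂ :- a₃)
               := con (+ 2) :* y₁ :+ a₁ :* x₂ :+ a₃ :- (y₁ :- y₂)) refl a₁ a₃ x₂ y₁ y₂ ⟩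
        tangentDen x₂ y₁ - (y₁ - y₂)
          ≈⟨ +-cong (+-congʳ (+-congˡ (*-congˡ (sym x₁≈x₂)))) (-‿cong y₁-y₂≈0) ⟩
        tangentDen x₁ y₁ - 0#
          ≈⟨ +-congʳ den≈0 ⟩
        0# - 0#
          ≈⟨ -‿inverseʳ 0# ⟩
        0# ∎))
      where
      open ≈-Reasoning
      y₁-y₂≈0 : y₁ - y₂ ≈ 0#
      y₁-y₂≈0 = *-cancelˡ-0 (λ eq → y₁≉-y₂ (x∙y⁻¹≈ε⇒x≈y _ _ eq)) (begin
        (y₁ - negY x₂ y₂) * (y₁ - y₂)
          ≈⟨ solve 5 (λ a₁ a₃ x₂ y₁ y₂ →
               (y₁ :- (:- y₂ :- a₁ :* x₂ :- a₃)) :* (y₁ :- y₂)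
               := y₁ :^ 2 :+ a₁ :* x₂ :* y₁ :+ a₃ :* y₁
                  :- (y₂ :^ 2 :+ a₁ :* x₂ :* y₂ :+ a₃ :* y₂)) refl a₁ a₃ x₂ y₁ y₂ ⟩
        y₁ ^ 2 + a₁ * x₂ * y₁ + a₃ * y₁ - (y₂ ^ 2 + a₁ * x₂ * y₂ + a₃ * y₂)
          ≈⟨ x≈y⇒x∙y⁻¹≈ε (trans (OnCurve-resp x₁≈x₂ refl e₁) (sym e₂)) ⟩
        0# ∎)

    quotient : (n d : Carrier) → d ≉ 0# → Carrier
    quotient n d d≉0 = n * inv d d≉0

    quotient-eq : ∀ n d (d≉0 : d ≉ 0#) → quotient n d d≉0 * d ≈ n
    quotient-eq n d d≉0 =
      trans (*-assoc _ _ _) (trans (*-congˡ (inv-inverseˡ d≉0)) (*-identityʳ n))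

    infix  8 ⊖_
    infixl 6 _⊕_

    ⊖_ : Point → Point
    ⊖ 𝒪            = 𝒪
    ⊖ affine x y e = affine x (negY x y) (negY-onCurve e)

    _⊕_ : Point → Point → Point
    𝒪                ⊕ Q             = Q
    P@(affine _ _ _) ⊕ 𝒪             = P
    affine x₁ y₁ e₁  ⊕ affine x₂ y₂ e₂ with x₁ ≟ x₂ | y₁ ≟ negY x₂ y₂
    ... | yes _     | yes _      = 𝒪
    ... | yes x₁≈x₂ | no  y₁≉-y₂ =
      let den≉0 = tangentDen≉0 e₁ e₂ x₁≈x₂ y₁≉-y₂
          m     = quotient (tangentNum x₁ y₁) (tangentDen x₁ y₁) den≉0
      in ⊖ affine (thirdX m x₁ x₂) (line m x₁ y₁ (thirdX m x₁ x₂))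
             (tangent-onCurve e₁ x₁≈x₂ (quotient-eq _ _ den≉0))
    ... | no  x₁≉x₂ | _          =
      let den≉0 = λ eq → x₁≉x₂ (x∙y⁻¹≈ε⇒x≈y _ _ eq)
          m     = quotient (y₁ - y₂) (x₁ - x₂) den≉0
      in ⊖ affine (thirdX m x₁ x₂) (line m x₁ y₁ (thirdX m x₁ x₂))
             (chord-onCurve e₁ e₂ den≉0 (quotient-eq _ _ den≉0))

  -- A raw group, since associativity of the chord-and-tangent law is not proved here.
  pointGroup : EllipticCurve → RawGroup (c ⊔ ℓ) (c ⊔ ℓ)
  pointGroup E = record
    { Carrier = Point
    ; _≈_     = _≈ₚ_
    ; _∙_     = _⊕_
    ; ε       = 𝒪
    ; _⁻¹     = ⊖_
    }
    where open Points (EllipticCurve.curve E)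

  HasRationalPointOfOrder : EllipticCurve → ℕ → Set (c ⊔ ℓ)
  HasRationalPointOfOrder E n = ∃[ P ] HasOrder n P
    where open GroupNotions (pointGroup E)

  HasCyclicTorsion : EllipticCurve → ℕ → Set (c ⊔ ℓ)
  HasCyclicTorsion E n = IsCyclic (Torsion n)
    where open GroupNotions (pointGroup E)

  -- y² + a x y + y = x³
  family : Carrier → WeierstrassCurve
  family a = weierstrass a 0# 1# 0# 0#

module Submission where

-- On an elliptic curve 3P = O says exactly that P is a flex: the tangent at P
-- meets the curve three times in P.  Move one flex to the origin with tangent
-- y = 0, so that the equation becomes y² + Axy + By = x³; scaling by a cube
-- root of B then gives B = 1.  If another flex (X, Y) has a tangent of slope
-- M ≠ 0, restricting the equation to that tangent gives
-- x³ - y (y + Ax + B) = (x - X)³, and its intersection with y = 0 has an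
-- abscissa ξ with ξ³ = (ξ - X)³.  As q ≡ 2 (mod 3), Fermat's theorem makes
-- cubing bijective on F_q, so X = 0; if M = 0, then 3X = M² + AM = 0 and 3 ≠ 0
-- in F_q.  Hence only the origin and its inverse are flexes.

open import Algebra.Bundles using (CommutativeMonoid)
import Algebra.Properties.AbelianGroup
import Algebra.Properties.CommutativeMonoid.Sum
import Algebra.Properties.Semiring.Exp
import Algebra.Properties.Semiring.Mult
import Algebra.Properties.Semiring.Mult.TCOptimised
import Algebra.Solver.Ring
open import Data.Fin.Base using (zero; suc; punchIn)
open import Data.Fin.Properties using (punchInᵢ≢i)
open import Data.Integer.Base as ℤ using () renaming (+_ to pos)
import Data.Integer.Properties as ℤ
open import Data.Nat as ℕ using (ℕ; zero; suc)
open import Data.Nat.Divisibility using (_∣_; divides)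
import Data.Nat.Properties as ℕ
import Data.Nat.Tactic.RingSolver as NatSolver
open import Data.Product using (Σ-syntax; ∃-syntax; _×_; _,_)
open import Data.Sum using (_⊎_; inj₁; inj₂; [_,_]′)
open import Data.Vec.Functional using (Vector; replicate)
open import Defs
open import Function.Base using (_∘_)
open import Function.Bundles using (Inverse)
import Function.Properties.Inverse as Inv
open import Relation.Binary.PropositionalEquality as ≡ using (_≡_; _≢_)
import Relation.Binary.Reasoning.Setoid
open import Relation.Nullary using (yes; no; contradiction)

-- Finite fields: sums over all elements and Fermat's theorem

module SingleTerm {c ℓ} (M : CommutativeMonoid c ℓ) where

  open CommutativeMonoid M
  open Algebra.Properties.CommutativeMonoid.Sum M

  sum-single : ∀ {n} (t : Vector Carrier n) i → (∀ j → j ≢ i → t j ≈ ε) → sum t ≈ t i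
  sum-single {suc n} t i t≈ε =
    trans (sum-remove {i = i} t)
      (trans (∙-congˡ (trans (sum-cong-≋ {n} (λ j → t≈ε (punchIn i j) (punchInᵢ≢i i j)))
                             (sum-replicate-zero n)))
             (identityʳ (t i)))

module FiniteFieldProperties {c ℓ} (F : FiniteField c ℓ) where

  open FiniteField F hiding (zero)
  open IntegerSolver commutativeRing
  open Algebra.Properties.Semiring.Exp semiring
  open Algebra.Properties.AbelianGroup +-abelianGroup
    using (x≈y⇒x∙y⁻¹≈ε; x∙y⁻¹≈ε⇒x≈y)
  private
    module Mult  = Algebra.Properties.Semiring.Mult semiring
    module Mult′ = Algebra.Properties.Semiring.Mult.TCOptimised semiring
    module ≈-Reasoning = Relation.Binary.Reasoning.Setoid setoid
    module Enum = Inverse enumeration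

  *-nonzero : ∀ {x y} → x ≉ 0# → y ≉ 0# → x * y ≉ 0#
  *-nonzero x≉0 y≉0 xy≈0 = y≉0 (*-cancelˡ-0 x≉0 xy≈0)

  *-cancelˡ : ∀ {x y z} → x ≉ 0# → x * y ≈ x * z → y ≈ z
  *-cancelˡ {x} {y} {z} x≉0 xy≈xz = x∙y⁻¹≈ε⇒x≈y _ _ (*-cancelˡ-0 x≉0 (trans
    (solve 3 (λ x y z → x :* (y :- z) := x :* y :- x :* z) refl x y z)
    (x≈y⇒x∙y⁻¹≈ε xy≈xz)))

  elements : Vector Carrier order
  elements = Enum.from

  module SumOver (M : CommutativeMonoid c ℓ) where

    private module M = CommutativeMonoid M
    open Algebra.Properties.CommutativeMonoid.Sum M public

    -- Conjugation by the enumeration turns `σ` into a permutation of the indices, which leaves sums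
    -- unchanged. An element is recovered from its index only up to `≈`, hence `f-cong`.
    sum-bijection : ∀ (f : Carrier → M.Carrier) → (∀ {x y} → x ≈ y → f x M.≈ f y) →
      (σ : Inverse setoid setoid) →
      sum (f ∘ elements) M.≈ sum (f ∘ Inverse.to σ ∘ elements)
    sum-bijection f f-cong σ = M.trans
      (sum-permute (f ∘ elements) (Inv.trans (Inv.sym enumeration) (Inv.trans σ enumeration)))
      (sum-cong-≋ {order} (λ _ → f-cong (Enum.strictlyInverseʳ _)))

  +-bijection : Carrier → Inverse setoid setoid
  +-bijection a = record
    { to        = a +_
    ; from      = - a +_
    ; to-cong   = +-congˡ
    ; from-cong = +-congˡ
    ; inverse   =
        (λ {x} y≈ → trans (+-congˡ y≈) (solve 2 (λ a x → a :+ (:- a :+ x) := x) refl a x))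
      , (λ {x} y≈ → trans (+-congˡ y≈) (solve 2 (λ a x → :- a :+ (a :+ x) := x) refl a x))
    }

  *-bijection : ∀ a → a ≉ 0# → Inverse setoid setoid
  *-bijection a a≉0 = record
    { to        = a *_
    ; from      = a⁻¹ *_
    ; to-cong   = *-congˡ
    ; from-cong = *-congˡ
    ; inverse   =
        (λ y≈ → trans (*-congˡ y≈) (cancel (trans (*-comm a a⁻¹) (inv-inverseˡ a≉0))))
      , (λ y≈ → trans (*-congˡ y≈) (cancel (inv-inverseˡ a≉0)))
    }
    where
    a⁻¹ = inv a a≉0
    cancel : ∀ {x y z} → x * y ≈ 1# → x * (y * z) ≈ z
    cancel xy≈1 = trans (sym (*-assoc _ _ _)) (trans (*-congʳ xy≈1) (*-identityˡ _))

  -- Translation by 1 permutes the field, so the sum `S` of all elements equals `S` plus `order`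
  -- copies of 1.
  order·1≈0 : fromℕ order ≈ 0#
  order·1≈0 = begin
    fromℕ order                    ≈⟨ Mult′.×ᵤ≈× order 1# ⟨
    order Mult.× 1#                ≈⟨ sum-replicate order ⟨
    sum (replicate order 1#)       ≈⟨ solve 2 (λ o s → o := o :+ s :- s) refl _ S ⟩
    sum (replicate order 1#) + S - S
      ≈⟨ +-congʳ (∑-distrib-+ (replicate order 1#) elements) ⟨
    sum (λ i → 1# + elements i) - S
      ≈⟨ x≈y⇒x∙y⁻¹≈ε (sym (sum-bijection (λ x → x) (λ x≈y → x≈y) (+-bijection 1#))) ⟩
    0#                             ∎
    where
    open ≈-Reasoning
    open SumOver +-commutativeMonoid
    S = sum elements

  ifZero : Carrier → Carrier → Carrier → Carrier
  ifZero a b y with y ≟ 0#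
  ... | yes _ = a
  ... | no  _ = b

  -- With the value 1 at zero, the product of the nonzero elements can be taken over the whole
  -- enumeration.
  nonzeroPart : Carrier → Carrier
  nonzeroPart y = ifZero 1# y y

  ifZero-zero : ∀ {a b y} → y ≈ 0# → ifZero a b y ≈ a
  ifZero-zero {y = y} y≈0 with y ≟ 0#
  ... | yes _   = refl
  ... | no  y≉0 = contradiction y≈0 y≉0

  ifZero-nonzero : ∀ {a b y} → y ≉ 0# → ifZero a b y ≈ b
  ifZero-nonzero {y = y} y≉0 with y ≟ 0#
  ... | yes y≈0 = contradiction y≈0 y≉0
  ... | no  _   = refl

  nonzeroPart-cong : ∀ {x y} → x ≈ y → nonzeroPart x ≈ nonzeroPart y
  nonzeroPart-cong {x} {y} x≈y with x ≟ 0# | y ≟ 0#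
  ... | yes _   | yes _   = refl
  ... | yes x≈0 | no  y≉0 = contradiction (trans (sym x≈y) x≈0) y≉0
  ... | no  x≉0 | yes y≈0 = contradiction (trans x≈y y≈0) x≉0
  ... | no  _   | no  _   = x≈y

  nonzeroPart≉0 : ∀ y → nonzeroPart y ≉ 0#
  nonzeroPart≉0 y with y ≟ 0#
  ... | yes _   = 1≉0
  ... | no  y≉0 = y≉0

  -- At y = 0 both nonzero parts are 1, so the factor x is missing on the left.
  nonzeroPart-scale : ∀ {x} y → x ≉ 0# →
    ifZero x 1# y * nonzeroPart (x * y) ≈ x * nonzeroPart y
  nonzeroPart-scale {x} y x≉0 with y ≟ 0#
  ... | yes y≈0 = *-congˡ (ifZero-zero (trans (*-congˡ y≈0) (zeroʳ x)))
  ... | no  y≉0 = trans (*-identityˡ _) (ifZero-nonzero (*-nonzero x≉0 y≉0))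

  private module Product = SumOver *-commutativeMonoid
  open Product using () renaming (sum to product)

  product≉0 : ∀ {n} (t : Vector Carrier n) → (∀ i → t i ≉ 0#) → product t ≉ 0#
  product≉0 {zero}  t t≉0 = 1≉0
  product≉0 {suc n} t t≉0 = *-nonzero (t≉0 zero) (product≉0 (t ∘ suc) (t≉0 ∘ suc))

  -- Zero is enumerated exactly once and contributes the factor `x`; all other factors are 1.
  product-ifZero : ∀ x → product (ifZero x 1# ∘ elements) ≈ x
  product-ifZero x = trans
    (SingleTerm.sum-single *-commutativeMonoid _ (Enum.to 0#)
      (λ j j≢ → ifZero-nonzero (λ e → j≢ (≡.trans (≡.sym (Enum.strictlyInverseˡ j)) (Enum.to-cong e)))))
    (ifZero-zero (Enum.strictlyInverseʳ 0#))

  -- The product of `x * nonzeroPart y` over all `y` is evaluated twice. Pulling out `x` gives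
  -- `x ^ order * P`. Absorbing `x`, since multiplication by it permutes the field, gives `P` and
  -- one `x` left over from `y = 0`.
  fermat-nonzero : ∀ {x} → x ≉ 0# → x ^ order ≈ x
  fermat-nonzero {x} x≉0 = *-cancelˡ (product≉0 (nonzeroPart ∘ elements) (nonzeroPart≉0 ∘ elements)) (begin
    P * x ^ order
      ≈⟨ *-comm _ _ ⟩
    x ^ order * P
      ≈⟨ *-congʳ (Product.sum-replicate order) ⟨
    product (replicate order x) * P
      ≈⟨ Product.∑-distrib-+ (replicate order x) (nonzeroPart ∘ elements) ⟨
    product (λ i → x * nonzeroPart (elements i))
      ≈⟨ Product.sum-cong-≋ {order} (λ i → nonzeroPart-scale (elements i) x≉0) ⟨
    product (λ i → ifZero x 1# (elements i) * nonzeroPart (x * elements i))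
      ≈⟨ Product.∑-distrib-+ (ifZero x 1# ∘ elements) (λ i → nonzeroPart (x * elements i)) ⟩
    product (ifZero x 1# ∘ elements) * product (λ i → nonzeroPart (x * elements i))
      ≈⟨ *-cong (product-ifZero x)
           (sym (Product.sum-bijection nonzeroPart nonzeroPart-cong (*-bijection x x≉0))) ⟩
    x * P
      ≈⟨ *-comm _ _ ⟩
    P * x ∎)
    where
    open ≈-Reasoning
    P = product (nonzeroPart ∘ elements)

  0^order≈0 : 0# ^ order ≈ 0#
  -- `Enum.to 0#` inhabits `Fin order` and so excludes order zero, where the power would be 1.
  0^order≈0 with order | Enum.to 0#
  ... | suc n | _ = zeroˡ _

  fermat : ∀ x → x ^ order ≈ x
  fermat x with x ≟ 0#
  ... | no  x≉0 = fermat-nonzero x≉0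
  ... | yes x≈0 = trans (^-congˡ order x≈0) (trans 0^order≈0 (sym x≈0))

  -- Cube roots for q ≡ 2 (mod 3)

  module OrderTwoModThree (k : ℕ) (order≡ : order ≡ 2 ℕ.+ k ℕ.* 3) where

    -- If 3 = 0, then q = 2 + 3k is 2 in the field; it is also 0, so 1 = 3 - 2 = 0.
    3≉0 : fromℕ 3 ≉ 0#
    3≉0 3≈0 = 1≉0 (begin
      1#
        ≈⟨ solve 0 (con (pos 1) := con (pos 3) :- con (pos 2)) refl ⟩
      fromℕ 3 - fromℕ 2
        ≈⟨ +-cong 3≈0 (-‿cong (trans (sym order≈2) order·1≈0)) ⟩
      0# - 0#
        ≈⟨ -‿inverseʳ 0# ⟩
      0# ∎)
      where
      open ≈-Reasoning
      order≈2 : fromℕ order ≈ fromℕ 2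
      order≈2 = begin
        fromℕ order                        ≡⟨ ≡.cong fromℕ order≡ ⟩
        fromℕ (2 ℕ.+ k ℕ.* 3)              ≈⟨ Mult′.×-homo-+ 1# 2 (k ℕ.* 3) ⟩
        fromℕ 2 + fromℕ (k ℕ.* 3)          ≈⟨ +-congˡ (Mult′.×1-homo-* k 3) ⟩
        fromℕ 2 + fromℕ k * fromℕ 3        ≈⟨ +-congˡ (trans (*-congˡ 3≈0) (zeroʳ _)) ⟩
        fromℕ 2 + 0#                       ≈⟨ +-identityʳ _ ⟩
        fromℕ 2                            ∎

    -- The exponent inverts 3 modulo q - 1: for q = 2 + 3k, 3 (1 + 2k) = 1 + 2 (q - 1).
    cubeRoot : Carrier → Carrier
    cubeRoot x = x ^ (1 ℕ.+ k ℕ.* 2)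

    cubeRoot-cong : ∀ {x y} → x ≈ y → cubeRoot x ≈ cubeRoot y
    cubeRoot-cong = ^-congˡ (1 ℕ.+ k ℕ.* 2)

    3[1+2k]≡2q-1 : ∀ k → (1 ℕ.+ k ℕ.* 2) ℕ.* 3 ≡ 2 ℕ.+ k ℕ.* 3 ℕ.+ (1 ℕ.+ k ℕ.* 3)
    3[1+2k]≡2q-1 = NatSolver.solve-∀

    -- Splitting the exponent 2q - 1 as q + (q - 1) lets Fermat's theorem apply twice without
    -- dividing by `x`, so zero is covered too.
    fermat-twice : ∀ x → x ^ ((1 ℕ.+ k ℕ.* 2) ℕ.* 3) ≈ x
    fermat-twice x = begin
      x ^ ((1 ℕ.+ k ℕ.* 2) ℕ.* 3)
        ≡⟨ ≡.cong (x ^_) (3[1+2k]≡2q-1 k) ⟩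
      x ^ (2 ℕ.+ k ℕ.* 3 ℕ.+ (1 ℕ.+ k ℕ.* 3))
        ≈⟨ ^-homo-* x (2 ℕ.+ k ℕ.* 3) (1 ℕ.+ k ℕ.* 3) ⟩
      x ^ (2 ℕ.+ k ℕ.* 3) * x ^ (1 ℕ.+ k ℕ.* 3)
        ≈⟨ *-congʳ x^q≈x ⟩
      -- `x` times its power 1 + 3k is this power by definition.
      x ^ (2 ℕ.+ k ℕ.* 3)
        ≈⟨ x^q≈x ⟩
      x ∎
      where
      open ≈-Reasoning
      x^q≈x : x ^ (2 ℕ.+ k ℕ.* 3) ≈ x
      x^q≈x = trans (reflexive (≡.cong (x ^_) (≡.sym order≡))) (fermat x)

    cubeRoot^3 : ∀ x → cubeRoot x ^ 3 ≈ x
    cubeRoot^3 x = trans (^-assocʳ x (1 ℕ.+ k ℕ.* 2) 3) (fermat-twice x)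

    -- The exponents 3 and 1 + 2k commute, so `cubeRoot` is also a left inverse of cubing.
    cube-injective : ∀ {x y} → x ^ 3 ≈ y ^ 3 → x ≈ y
    cube-injective {x} {y} x³≈y³ = trans (sym (root x)) (trans (cubeRoot-cong x³≈y³) (root y))
      where
      root : ∀ x → cubeRoot (x ^ 3) ≈ x
      root x = trans (^-assocʳ x 3 (1 ℕ.+ k ℕ.* 2))
        (trans (reflexive (≡.cong (x ^_) (ℕ.*-comm 3 (1 ℕ.+ k ℕ.* 2)))) (fermat-twice x))

  order-form : 3 ∣ order ℕ.+ 1 → ∃[ k ] order ≡ 2 ℕ.+ k ℕ.* 3
  order-form (divides zero    eq) = contradiction (≡.trans (ℕ.+-comm 1 order) eq) λ ()
  order-form (divides (suc k) eq) = k , ℕ.suc-injective (≡.trans (ℕ.+-comm 1 order) eq)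

-- The discriminant under changes of variables

module WeierstrassProperties {c ℓ} (F : FiniteField c ℓ) where

  open FiniteField F hiding (zero)
  open FiniteFieldProperties F
  open IntegerSolver commutativeRing using (fromℕ; almostCommutativeRing; fromℤ-morphism; fromℤ-≟)
  open Algebra.Solver.Ring ℤ.+-*-rawRing almostCommutativeRing fromℤ-morphism fromℤ-≟
  open Algebra.Properties.Semiring.Exp semiring
  open Algebra.Properties.AbelianGroup +-abelianGroup
    using (x≈y⇒x∙y⁻¹≈ε; x∙y⁻¹≈ε⇒x≈y)
  open EllipticCurves F
  open WeierstrassCurve using (Δ)
  private
    module ≈-Reasoning = Relation.Binary.Reasoning.Setoid setoid

  Δ-polynomial : ∀ {n} (a₁ a₂ a₃ a₄ a₆ : Polynomial n) → Polynomial n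
  Δ-polynomial a₁ a₂ a₃ a₄ a₆ =
    :- (b₂ :^ 2 :* b₈) :- con (pos 8) :* b₄ :^ 3 :- con (pos 27) :* b₆ :^ 2
    :+ con (pos 9) :* b₂ :* b₄ :* b₆
    where
    b₂ = a₁ :^ 2 :+ con (pos 4) :* a₂
    b₄ = con (pos 2) :* a₄ :+ a₁ :* a₃
    b₆ = a₃ :^ 2 :+ con (pos 4) :* a₆
    b₈ = a₁ :^ 2 :* a₆ :+ con (pos 4) :* a₂ :* a₆ :- a₁ :* a₃ :* a₄ :+ a₂ :* a₃ :^ 2 :- a₄ :^ 2

  -‿cong₂ : ∀ {x x′ y y′} → x ≈ x′ → y ≈ y′ → x - y ≈ x′ - y′
  -‿cong₂ x≈ y≈ = +-cong x≈ (-‿cong y≈)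

  Δ-cong : ∀ {a₁ a₂ a₃ a₄ a₆ a₁′ a₂′ a₃′ a₄′ a₆′} →
    a₁ ≈ a₁′ → a₂ ≈ a₂′ → a₃ ≈ a₃′ → a₄ ≈ a₄′ → a₆ ≈ a₆′ →
    Δ (weierstrass a₁ a₂ a₃ a₄ a₆) ≈ Δ (weierstrass a₁′ a₂′ a₃′ a₄′ a₆′)
  Δ-cong a₁≈ a₂≈ a₃≈ a₄≈ a₆≈ =
    +-cong
      (-‿cong₂
        (-‿cong₂ (-‿cong (*-cong (^-congˡ 2 b₂≈) b₈≈)) (*-congˡ (^-congˡ 3 b₄≈)))
        (*-congˡ (^-congˡ 2 b₆≈)))
      (*-cong (*-cong (*-congˡ b₂≈) b₄≈) b₆≈)
    where
    b₂≈ = +-cong (^-congˡ 2 a₁≈) (*-congˡ a₂≈)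
    b₄≈ = +-cong (*-congˡ a₄≈) (*-cong a₁≈ a₃≈)
    b₆≈ = +-cong (^-congˡ 2 a₃≈) (*-congˡ a₆≈)
    b₈≈ = -‿cong₂
      (+-cong
        (-‿cong₂ (+-cong (*-cong (^-congˡ 2 a₁≈) a₆≈) (*-cong (*-congˡ a₂≈) a₆≈))
                 (*-cong (*-cong a₁≈ a₃≈) a₄≈))
        (*-cong a₂≈ (^-congˡ 2 a₃≈)))
      (^-congˡ 2 a₄≈)

  -- The new coefficients are the right-hand sides in `_≅_`, that is, those after the change of
  -- variables with u = 1.
  Δ-translate : ∀ a₁ a₂ a₃ a₄ a₆ r s t →
    Δ (weierstrass a₁ a₂ a₃ a₄ a₆) ≈
    Δ (weierstrass
        (a₁ + fromℕ 2 * s)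
        (a₂ - s * a₁ + fromℕ 3 * r - s ^ 2)
        (a₃ + r * a₁ + fromℕ 2 * t)
        (a₄ - s * a₃ + fromℕ 2 * r * a₂ - (t + r * s) * a₁ + fromℕ 3 * r ^ 2 - fromℕ 2 * s * t)
        (a₆ + r * a₄ + r ^ 2 * a₂ + r ^ 3 - t * a₃ - t ^ 2 - r * t * a₁))
  Δ-translate = solve 8 (λ a₁ a₂ a₃ a₄ a₆ r s t →
    Δ-polynomial a₁ a₂ a₃ a₄ a₆ :=
    Δ-polynomial
      (a₁ :+ con (pos 2) :* s)
      (a₂ :- s :* a₁ :+ con (pos 3) :* r :- s :^ 2)
      (a₃ :+ r :* a₁ :+ con (pos 2) :* t)
      (a₄ :- s :* a₃ :+ con (pos 2) :* r :* a₂ :- (t :+ r :* s) :* a₁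
        :+ con (pos 3) :* r :^ 2 :- con (pos 2) :* s :* t)
      (a₆ :+ r :* a₄ :+ r :^ 2 :* a₂ :+ r :^ 3 :- t :* a₃ :- t :^ 2 :- r :* t :* a₁)) refl

  -- If each coefficient is given its index as weight, the discriminant is homogeneous of weight 12.
  Δ-scale : ∀ u a₁ a₂ a₃ a₄ a₆ →
    Δ (weierstrass (u * a₁) (u ^ 2 * a₂) (u ^ 3 * a₃) (u ^ 4 * a₄) (u ^ 6 * a₆)) ≈
    u ^ 12 * Δ (weierstrass a₁ a₂ a₃ a₄ a₆)
  Δ-scale = solve 6 (λ u a₁ a₂ a₃ a₄ a₆ →
    Δ-polynomial (u :* a₁) (u :^ 2 :* a₂) (u :^ 3 :* a₃) (u :^ 4 :* a₄) (u :^ 6 :* a₆)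
    := u :^ 12 :* Δ-polynomial a₁ a₂ a₃ a₄ a₆) refl

  Δ-≅ : ∀ {W W′} (i : W ≅ W′) → Δ W ≈ _≅_.u i ^ 12 * Δ W′
  Δ-≅ i = trans (Δ-translate _ _ _ _ _ r s t) (trans
    (sym (Δ-cong a₁-eq a₂-eq a₃-eq a₄-eq a₆-eq))
    (Δ-scale u _ _ _ _ _))
    where open _≅_ i

  -- 27 is written as a cube so that injectivity of cubing applies.
  Δ-family : ∀ a → Δ (family a) ≈ a ^ 3 - fromℕ 3 ^ 3
  Δ-family = solve 1 (λ a →
    Δ-polynomial a (con (pos 0)) (con (pos 1)) (con (pos 0)) (con (pos 0))
    := a :^ 3 :- con (pos 3) :^ 3) refl

  -- Flexes and 3-torsion

  module Flexes (W : WeierstrassCurve) where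

    open WeierstrassCurve W hiding (Δ)
    open Points W

    -- `m` is the slope of the tangent, whose third intersection again has abscissa `x`. The slope
    -- equation is cleared of its denominator, ready for polynomial identities.
    Flex : (x y m : Carrier) → Set ℓ
    Flex x y m = m * tangentDen x y ≈ tangentNum x y × thirdX m x x ≈ x

    -- Of the three branches for affine points in `_⊕_`, only the vertical one returns `𝒪`.
    ⊕≈𝒪⇒inverse : ∀ {x₁ y₁ x₂ y₂} e₁ e₂ →
      affine x₁ y₁ e₁ ⊕ affine x₂ y₂ e₂ ≈ₚ 𝒪 → x₁ ≈ x₂ × y₁ ≈ negY x₂ y₂
    ⊕≈𝒪⇒inverse {x₁} {y₁} {x₂} {y₂} e₁ e₂ sum≈𝒪 with x₁ ≟ x₂ | y₁ ≟ negY x₂ y₂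
    ... | yes x₁≈x₂ | yes y₁≈ = x₁≈x₂ , y₁≈
    ⊕≈𝒪⇒inverse e₁ e₂ () | yes _ | no _
    ⊕≈𝒪⇒inverse e₁ e₂ () | no _ | _

    inverse⇒⊕≈𝒪 : ∀ {x₁ y₁ x₂ y₂} e₁ e₂ → x₁ ≈ x₂ → y₁ ≈ negY x₂ y₂ →
      affine x₁ y₁ e₁ ⊕ affine x₂ y₂ e₂ ≈ₚ 𝒪
    inverse⇒⊕≈𝒪 {x₁} {y₁} {x₂} {y₂} e₁ e₂ x₁≈x₂ y₁≈ with x₁ ≟ x₂ | y₁ ≟ negY x₂ y₂
    ... | yes _     | yes _  = 𝒪≈𝒪
    ... | yes _     | no y₁≉ = contradiction y₁≈ y₁≉
    ... | no  x₁≉x₂ | _      = contradiction x₁≈x₂ x₁≉x₂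

    -- The abscissa of 2P is that of the third point on the tangent, and P + 2P = `𝒪` makes it `x`.
    -- A vertical tangent would give 2P = `𝒪` and 3P = P.
    3·≈𝒪⇒flex : ∀ {x y} e → let P = affine x y e in P ⊕ (P ⊕ (P ⊕ 𝒪)) ≈ₚ 𝒪 →
      tangentDen x y ≉ 0# × ∃[ m ] Flex x y m
    3·≈𝒪⇒flex {x} {y} e 3P≈𝒪 with x ≟ x | y ≟ negY x y
    3·≈𝒪⇒flex e () | yes _ | yes _
    ... | yes x≈x | no y≉ =
      let x≈X , _ = ⊕≈𝒪⇒inverse _ _ 3P≈𝒪 in den≉0 , _ , quotient-eq _ _ den≉0 , sym x≈X
      where den≉0 = tangentDen≉0 e e x≈x y≉
    ... | no x≉x | _ = contradiction refl x≉x

    -- Cancelling the denominator identifies the slope used by `_⊕_` with `m`. The third point on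
    -- the tangent is then P itself, so 2P = -P.
    flex⇒3·≈𝒪 : ∀ {x y m} e → tangentDen x y ≉ 0# → Flex x y m →
      let P = affine x y e in P ⊕ (P ⊕ (P ⊕ 𝒪)) ≈ₚ 𝒪
    flex⇒3·≈𝒪 {x} {y} {m} e den≉0 (slope , X≈x) with x ≟ x | y ≟ negY x y
    -- `tangentDen x y` equals `y - negY x y`, so it would vanish here.
    ... | yes _ | yes y≈ = contradiction
      (trans
        (solve 4 (λ a₁ a₃ x y → con (pos 2) :* y :+ a₁ :* x :+ a₃ := y :- (:- y :- a₁ :* x :- a₃))
          refl a₁ a₃ x y)
        (x≈y⇒x∙y⁻¹≈ε y≈))
      den≉0
    ... | yes x≈x | no y≉ = inverse⇒⊕≈𝒪 _ _ (sym X′≈x) (begin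
        y
          ≈⟨ line-start m′ x y ⟨
        line m′ x y x
          ≈⟨ +-congʳ (*-congˡ (+-congʳ X′≈x)) ⟨
        Y′
          ≈⟨ solve 4 (λ a₁ a₃ x y →
               y := :- (:- y :- a₁ :* x :- a₃) :- a₁ :* x :- a₃) refl a₁ a₃ X′ Y′ ⟩
        negY X′ (negY X′ Y′) ∎)
      where
      open ≈-Reasoning
      den≉0′ = tangentDen≉0 e e x≈x y≉
      m′ = quotient (tangentNum x y) (tangentDen x y) den≉0′
      X′ = thirdX m′ x x
      Y′ = line m′ x y X′
      m′≈m : m′ ≈ m
      m′≈m = *-cancelˡ den≉0 (trans (*-comm _ _)
        (trans (quotient-eq _ _ den≉0′) (trans (sym slope) (*-comm _ _))))
      X′≈x : X′ ≈ x
      X′≈x = trans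
        (+-congʳ (+-congʳ (+-congʳ (+-cong (^-congˡ 2 m′≈m) (*-congˡ m′≈m))))) X≈x
    ... | no x≉x | _ = contradiction refl x≉x

    -- The difference of the two curve equations factors as `(y₁ - negY x₂ y₂) * (y₁ - y₂)`.
    sameX⇒± : ∀ {x₁ y₁ x₂ y₂} → OnCurve x₁ y₁ → OnCurve x₂ y₂ → x₁ ≈ x₂ →
      y₁ ≈ y₂ ⊎ y₁ ≈ negY x₂ y₂
    sameX⇒± {x₁} {y₁} {x₂} {y₂} e₁ e₂ x₁≈x₂ with y₁ ≟ negY x₂ y₂
    ... | yes y₁≈ = inj₂ y₁≈
    ... | no  y₁≉ = inj₁ (x∙y⁻¹≈ε⇒x≈y _ _
      (*-cancelˡ-0 (λ eq → y₁≉ (x∙y⁻¹≈ε⇒x≈y _ _ eq)) (trans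
        (solve 5 (λ a₁ a₃ x₂ y₁ y₂ →
          (y₁ :- (:- y₂ :- a₁ :* x₂ :- a₃)) :* (y₁ :- y₂)
          := y₁ :^ 2 :+ a₁ :* x₂ :* y₁ :+ a₃ :* y₁
             :- (y₂ :^ 2 :+ a₁ :* x₂ :* y₂ :+ a₃ :* y₂)) refl a₁ a₃ x₂ y₁ y₂)
        (x≈y⇒x∙y⁻¹≈ε (trans (OnCurve-resp x₁≈x₂ refl e₁) (sym e₂))))))

  -- Uniqueness of flexes up to sign, and the normal form

  module _ (k : ℕ) (order≡ : order ≡ 2 ℕ.+ k ℕ.* 3) where

    open OrderTwoModThree k order≡

    -- The flex condition thirdX m x x ≈ x on y² + Axy + By = x³ reads m² + Am = 3x.
    origin-flex : ∀ A B x y m → y ^ 2 + A * x * y + B * y ≈ x ^ 3 →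
      m * (fromℕ 2 * y + A * x + B) ≈ fromℕ 3 * x ^ 2 - A * y →
      m ^ 2 + A * m ≈ fromℕ 3 * x → x ≈ 0#
    origin-flex A B x y m onCurve slope flex with m ≟ 0#
    ... | yes m≈0 = *-cancelˡ-0 3≉0 (begin
      fromℕ 3 * x             ≈⟨ flex ⟨
      m ^ 2 + A * m           ≈⟨ +-cong (^-congˡ 2 m≈0) (*-congˡ m≈0) ⟩
      0# ^ 2 + A * 0#         ≈⟨ solve 1 (λ A → con (pos 0) :^ 2 :+ A :* con (pos 0) := con (pos 0)) refl A ⟩
      0#                      ∎)
      where open ≈-Reasoning
    -- The tangent meets y = 0 at ξ = x - y/m. Multiplied by m³, the relation ξ³ = (ξ - x)³ becomes
    -- (mx - y)³ = (-y)³.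
    ... | no m≉0 = *-cancelˡ-0 m≉0 (begin
      m * x                   ≈⟨ solve 2 (λ z y → z := z :- y :+ y) refl (m * x) y ⟩
      m * x - y + y           ≈⟨ +-congʳ (cube-injective (x∙y⁻¹≈ε⇒x≈y _ _ cubes)) ⟩
      - y + y                 ≈⟨ -‿inverseˡ y ⟩
      0#                      ∎)
      where
      open ≈-Reasoning
      cubes : (m * x - y) ^ 3 - (- y) ^ 3 ≈ 0#
      cubes = begin
        (m * x - y) ^ 3 - (- y) ^ 3
          -- On the tangent, the Taylor coefficients of the equation at `x` are, up to sign, the
          -- curve, slope and flex expressions. The multipliers are the powers of ξ - x = -y/m,
          -- times m³.
          ≈⟨ solve 5 (λ A B x y m →
               (m :* x :- y) :^ 3 :- (:- y) :^ 3 :=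
               m :^ 2 :* y :* (m :* (con (pos 2) :* y :+ A :* x :+ B) :- (con (pos 3) :* x :^ 2 :- A :* y))
               :- m :^ 3 :* (y :^ 2 :+ A :* x :* y :+ B :* y :- x :^ 3)
               :- m :* y :^ 2 :* (m :^ 2 :+ A :* m :- con (pos 3) :* x)) refl A B x y m ⟩
        m ^ 2 * y * (m * (fromℕ 2 * y + A * x + B) - (fromℕ 3 * x ^ 2 - A * y))
          - m ^ 3 * (y ^ 2 + A * x * y + B * y - x ^ 3)
          - m * y ^ 2 * (m ^ 2 + A * m - fromℕ 3 * x)
          ≈⟨ -‿cong₂
               (-‿cong₂ (*-congˡ (x≈y⇒x∙y⁻¹≈ε slope)) (*-congˡ (x≈y⇒x∙y⁻¹≈ε onCurve)))
               (*-congˡ (x≈y⇒x∙y⁻¹≈ε flex)) ⟩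
        m ^ 2 * y * 0# - m ^ 3 * 0# - m * y ^ 2 * 0#
          ≈⟨ solve 3 (λ p q r →
               p :* con (pos 0) :- q :* con (pos 0) :- r :* con (pos 0) := con (pos 0)) refl _ _ _ ⟩
        0# ∎

    module _ (W : WeierstrassCurve) where

      open WeierstrassCurve W hiding (Δ)
      open Points W
      open Flexes W

      -- In the coordinates x₁ - x₀ and y₁ - y₀ - m₀ (x₁ - x₀) the first flex
      -- is the origin, with tangent y = 0.
      flexes-sameX : ∀ {x₀ y₀ m₀ x₁ y₁ m₁} → OnCurve x₀ y₀ → Flex x₀ y₀ m₀ →
        OnCurve x₁ y₁ → Flex x₁ y₁ m₁ → x₁ ≈ x₀
      flexes-sameX {x₀} {y₀} {m₀} {x₁} {y₁} {m₁} e₀ (slope₀ , flex₀) e₁ (slope₁ , flex₁) =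
        x∙y⁻¹≈ε⇒x≈y _ _ (origin-flex A B X Y M
          (x∙y⁻¹≈ε⇒x≈y _ _ onCurve) (x∙y⁻¹≈ε⇒x≈y _ _ slope) (x∙y⁻¹≈ε⇒x≈y _ _ flex))
        where
        open ≈-Reasoning
        -- `A` and `B` are the coefficients a₁ and a₃ after the change of variables with u = 1, r =
        -- x₀, s = m₀, t = y₀.
        A = a₁ + fromℕ 2 * m₀
        B = a₃ + x₀ * a₁ + fromℕ 2 * y₀
        X = x₁ - x₀
        Y = y₁ - y₀ - m₀ * X
        M = m₁ - m₀
        onCurve′ : (x y : Carrier) → Carrier
        slope′ : (x y m : Carrier) → Carrier
        flex′ : (x m : Carrier) → Carrier
        onCurve′ x y = y ^ 2 + a₁ * x * y + a₃ * y - (x ^ 3 + a₂ * x ^ 2 + a₄ * x + a₆)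
        slope′ x y m = m * tangentDen x y - tangentNum x y
        flex′ x m = thirdX m x x - x

        onCurveₚ : ∀ {n} (a₁ a₂ a₃ a₄ a₆ x y : Polynomial n) → Polynomial n
        slopeₚ : ∀ {n} (a₁ a₂ a₃ a₄ x y m : Polynomial n) → Polynomial n
        flexₚ : ∀ {n} (a₁ a₂ x m : Polynomial n) → Polynomial n
        onCurveₚ a₁ a₂ a₃ a₄ a₆ x y =
          y :^ 2 :+ a₁ :* x :* y :+ a₃ :* y :- (x :^ 3 :+ a₂ :* x :^ 2 :+ a₄ :* x :+ a₆)
        slopeₚ a₁ a₂ a₃ a₄ x y m =
          m :* (con (pos 2) :* y :+ a₁ :* x :+ a₃)
          :- (con (pos 3) :* x :^ 2 :+ con (pos 2) :* a₂ :* x :+ a₄ :- a₁ :* y)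
        flexₚ a₁ a₂ x m = m :^ 2 :+ a₁ :* m :- a₂ :- x :- x :- x

        onCurve₀ = x≈y⇒x∙y⁻¹≈ε e₀
        onCurve₁ = x≈y⇒x∙y⁻¹≈ε e₁
        slope₀≈0 = x≈y⇒x∙y⁻¹≈ε slope₀
        slope₁≈0 = x≈y⇒x∙y⁻¹≈ε slope₁
        flex₀≈0  = x≈y⇒x∙y⁻¹≈ε flex₀
        flex₁≈0  = x≈y⇒x∙y⁻¹≈ε flex₁

        onCurve : Y ^ 2 + A * X * Y + B * Y - X ^ 3 ≈ 0#
        onCurve = begin
          Y ^ 2 + A * X * Y + B * Y - X ^ 3
            -- The transformed a₆, a₄ and a₂ are minus the curve, slope and flex expressions at the
            -- first flex, hence zero.
            ≈⟨ solve 10 (λ a₁ a₂ a₃ a₄ a₆ x₀ y₀ m₀ x₁ y₁ →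
                 let A = a₁ :+ con (pos 2) :* m₀
                     B = a₃ :+ x₀ :* a₁ :+ con (pos 2) :* y₀
                     X = x₁ :- x₀
                     Y = y₁ :- y₀ :- m₀ :* X
                 in Y :^ 2 :+ A :* X :* Y :+ B :* Y :- X :^ 3
                 := onCurveₚ a₁ a₂ a₃ a₄ a₆ x₁ y₁ :- onCurveₚ a₁ a₂ a₃ a₄ a₆ x₀ y₀
                    :- X :* slopeₚ a₁ a₂ a₃ a₄ x₀ y₀ m₀ :- X :^ 2 :* flexₚ a₁ a₂ x₀ m₀)
                 refl a₁ a₂ a₃ a₄ a₆ x₀ y₀ m₀ x₁ y₁ ⟩
          onCurve′ x₁ y₁ - onCurve′ x₀ y₀ - X * slope′ x₀ y₀ m₀ - X ^ 2 * flex′ x₀ m₀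
            ≈⟨ -‿cong₂ (-‿cong₂ (-‿cong₂ onCurve₁ onCurve₀) (*-congˡ slope₀≈0)) (*-congˡ flex₀≈0) ⟩
          0# - 0# - X * 0# - X ^ 2 * 0#
            ≈⟨ solve 1 (λ X → con (pos 0) :- con (pos 0) :- X :* con (pos 0) :- X :^ 2 :* con (pos 0)
                 := con (pos 0)) refl X ⟩
          0# ∎

        slope : M * (fromℕ 2 * Y + A * X + B) - (fromℕ 3 * X ^ 2 - A * Y) ≈ 0#
        slope = begin
          M * (fromℕ 2 * Y + A * X + B) - (fromℕ 3 * X ^ 2 - A * Y)
            -- The slope expression is invariant under the change of variables; the subtracted terms
            -- come from the transformed a₄ and a₂.
            ≈⟨ solve 10 (λ a₁ a₂ a₃ a₄ x₀ y₀ m₀ x₁ y₁ m₁ →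
                 let A = a₁ :+ con (pos 2) :* m₀
                     B = a₃ :+ x₀ :* a₁ :+ con (pos 2) :* y₀
                     X = x₁ :- x₀
                     Y = y₁ :- y₀ :- m₀ :* X
                     M = m₁ :- m₀
                 in M :* (con (pos 2) :* Y :+ A :* X :+ B) :- (con (pos 3) :* X :^ 2 :- A :* Y)
                 := slopeₚ a₁ a₂ a₃ a₄ x₁ y₁ m₁ :- slopeₚ a₁ a₂ a₃ a₄ x₀ y₀ m₀
                    :- con (pos 2) :* X :* flexₚ a₁ a₂ x₀ m₀)
                 refl a₁ a₂ a₃ a₄ x₀ y₀ m₀ x₁ y₁ m₁ ⟩
          slope′ x₁ y₁ m₁ - slope′ x₀ y₀ m₀ - fromℕ 2 * X * flex′ x₀ m₀
            ≈⟨ -‿cong₂ (-‿cong₂ slope₁≈0 slope₀≈0) (*-congˡ flex₀≈0) ⟩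
          0# - 0# - fromℕ 2 * X * 0#
            ≈⟨ solve 1 (λ X → con (pos 0) :- con (pos 0) :- con (pos 2) :* X :* con (pos 0)
                 := con (pos 0)) refl X ⟩
          0# ∎

        flex : M ^ 2 + A * M - fromℕ 3 * X ≈ 0#
        flex = begin
          M ^ 2 + A * M - fromℕ 3 * X
            ≈⟨ solve 6 (λ a₁ a₂ x₀ m₀ x₁ m₁ →
                 let M = m₁ :- m₀
                 in M :^ 2 :+ (a₁ :+ con (pos 2) :* m₀) :* M :- con (pos 3) :* (x₁ :- x₀)
                 := flexₚ a₁ a₂ x₁ m₁ :- flexₚ a₁ a₂ x₀ m₀)
                 refl a₁ a₂ x₀ m₀ x₁ m₁ ⟩
          flex′ x₁ m₁ - flex′ x₀ m₀
            ≈⟨ -‿cong₂ flex₁≈0 flex₀≈0 ⟩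
          0# - 0#
            ≈⟨ -‿inverseʳ 0# ⟩
          0# ∎

      -- Moving the flex to the origin and its tangent to y = 0 kills a₂, a₄ and a₆, by the flex,
      -- slope and curve equations respectively. The remaining a₃ is `tangentDen x y`, and scaling
      -- by its cube root makes it 1.
      flex-≅-family : ∀ {x y m} → OnCurve x y → tangentDen x y ≉ 0# → Flex x y m →
        ∃[ a ] W ≅ family a
      flex-≅-family {x} {y} {m} e den≉0 (slope , X≈x) = inv u u≉0 * (a₁ + fromℕ 2 * m) , record
        { u = u ; r = x ; s = m ; t = y
        ; u≉0   = u≉0
        ; a₁-eq = trans (sym (*-assoc _ _ _)) (trans
            (*-congʳ (trans (*-comm _ _) (inv-inverseˡ u≉0))) (*-identityˡ _))
        ; a₂-eq = vanishes (trans
            (solve 4 (λ a₁ a₂ x m →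
               a₂ :- m :* a₁ :+ con (pos 3) :* x :- m :^ 2
               := x :- (m :^ 2 :+ a₁ :* m :- a₂ :- x :- x)) refl a₁ a₂ x m)
            (x≈y⇒x∙y⁻¹≈ε (sym X≈x)))
        ; a₃-eq = trans (*-identityʳ _) (trans (cubeRoot^3 _)
            (solve 4 (λ a₁ a₃ x y →
               con (pos 2) :* y :+ a₁ :* x :+ a₃ := a₃ :+ x :* a₁ :+ con (pos 2) :* y)
               refl a₁ a₃ x y))
        ; a₄-eq = vanishes (trans
            (solve 7 (λ a₁ a₂ a₃ a₄ x y m →
               a₄ :- m :* a₃ :+ con (pos 2) :* x :* a₂ :- (y :+ x :* m) :* a₁
                 :+ con (pos 3) :* x :^ 2 :- con (pos 2) :* m :* y
               := con (pos 3) :* x :^ 2 :+ con (pos 2) :* a₂ :* x :+ a₄ :- a₁ :* y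
                  :- m :* (con (pos 2) :* y :+ a₁ :* x :+ a₃)) refl a₁ a₂ a₃ a₄ x y m)
            (x≈y⇒x∙y⁻¹≈ε (sym slope)))
        ; a₆-eq = vanishes (trans
            (solve 7 (λ a₁ a₂ a₃ a₄ a₆ x y →
               a₆ :+ x :* a₄ :+ x :^ 2 :* a₂ :+ x :^ 3 :- y :* a₃ :- y :^ 2 :- x :* y :* a₁
               := x :^ 3 :+ a₂ :* x :^ 2 :+ a₄ :* x :+ a₆ :- (y :^ 2 :+ a₁ :* x :* y :+ a₃ :* y))
               refl a₁ a₂ a₃ a₄ a₆ x y)
            (x≈y⇒x∙y⁻¹≈ε (sym e)))
        }
        where
        u = cubeRoot (tangentDen x y)
        u≉0 : u ≉ 0#
        u≉0 u≈0 = den≉0 (trans (sym (cubeRoot^3 _)) (trans (*-congʳ u≈0) (zeroˡ _)))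
        vanishes : ∀ {v z} → z ≈ 0# → v * 0# ≈ z
        vanishes z≈0 = trans (zeroʳ _) (sym z≈0)

    -- Every affine 3-torsion point is a flex and so has the abscissa of P. This leaves only `𝒪`, P
    -- and -P, the multiples of P by 0, 1 and -1.
    cyclicTorsion : ∀ E x y e → let open Points (EllipticCurve.curve E)
                                    open GroupNotions (pointGroup E) in
      Torsion 3 (affine x y e) → HasCyclicTorsion E 3
    cyclicTorsion E x y e 3P≈𝒪 = affine x y e , 3P≈𝒪 , multiple
      where
      open Points (EllipticCurve.curve E)
      open Flexes (EllipticCurve.curve E)
      open GroupNotions (pointGroup E)
      multiple : ∀ Q → Torsion 3 Q → ∃[ k ] Q ≈ₚ k ·ℤ affine x y e
      multiple 𝒪 _ = pos 0 , 𝒪≈𝒪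
      multiple (affine x₁ y₁ e₁) 3Q≈𝒪 =
        let _ , _ , flex  = 3·≈𝒪⇒flex e 3P≈𝒪
            _ , _ , flex₁ = 3·≈𝒪⇒flex e₁ 3Q≈𝒪
            x₁≈x          = flexes-sameX (EllipticCurve.curve E) e flex e₁ flex₁
        in [ (λ y₁≈y  → pos 1 , affine≈affine x₁≈x y₁≈y)
           , (λ y₁≈-y → ℤ.-[1+ 0 ] , affine≈affine x₁≈x y₁≈-y)
           ]′ (sameX⇒± e₁ e x₁≈x)

    -- A zero discriminant means a³ = 3³, and for q ≡ 2 (mod 3) cubing is injective.
    Δ-family≈0⇒a≈3 : ∀ {a} → Δ (family a) ≈ 0# → a ≈ fromℕ 3
    Δ-family≈0⇒a≈3 {a} Δ≈0 = cube-injective (x∙y⁻¹≈ε⇒x≈y _ _ (trans (sym (Δ-family a)) Δ≈0))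

    a≈3⇒Δ-family≈0 : ∀ {a} → a ≈ fromℕ 3 → Δ (family a) ≈ 0#
    a≈3⇒Δ-family≈0 {a} a≈3 = trans (Δ-family a) (x≈y⇒x∙y⁻¹≈ε (^-congˡ 3 a≈3))

    normalForm : ∀ E → HasRationalPointOfOrder E 3 →
      (∃[ a ] a ≉ fromℕ 3 × EllipticCurve.curve E ≅ family a) × HasCyclicTorsion E 3
    -- `𝒪` has order 1, against the minimality of 3.
    normalForm E (Points.𝒪 , _ , _ , minimal) =
      contradiction Points.𝒪≈𝒪 (minimal 1 (ℕ.s≤s ℕ.z≤n) (ℕ.s≤s (ℕ.s≤s ℕ.z≤n)))
    normalForm E (Points.affine x y e , _ , 3P≈𝒪 , _) =
      let open EllipticCurve E
          den≉0 , _ , flex = Flexes.3·≈𝒪⇒flex curve e 3P≈𝒪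
          a , E≅ = flex-≅-family curve e den≉0 flex
          -- At a = 3 the family is singular, and `Δ-≅` would carry this back to `E`.
          a≉3 = λ a≈3 → nonsingular (trans (Δ-≅ E≅) (trans (*-congˡ (a≈3⇒Δ-family≈0 a≈3)) (zeroʳ _)))
      in (a , a≉3 , E≅) , cyclicTorsion E x y e 3P≈𝒪

    -- The origin is a flex of every curve in the family, with tangent y = 0, and so supplies the
    -- affine 3-torsion point that generates.
    family-cyclicTorsion : ∀ a → a ≉ fromℕ 3 →
      Σ[ Δ≉0 ∈ Δ (family a) ≉ 0# ] HasCyclicTorsion (elliptic (family a) Δ≉0) 3
    family-cyclicTorsion a a≉3 =
      Δ≉0 , cyclicTorsion (elliptic (family a) Δ≉0) 0# 0# origin
              (flex⇒3·≈𝒪 origin (λ den≈0 → 1≉0 (trans (sym den≈1) den≈0)) flex)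
      where
      open WeierstrassCurve (family a) using (OnCurve)
      open Points (family a)
      open Flexes (family a)
      Δ≉0 : Δ (family a) ≉ 0#
      Δ≉0 Δ≈0 = a≉3 (Δ-family≈0⇒a≈3 Δ≈0)
      z : ∀ {n} → Polynomial n
      z = con (pos 0)
      origin : OnCurve 0# 0#
      origin = solve 1 (λ a →
        z :^ 2 :+ a :* z :* z :+ con (pos 1) :* z := z :^ 3 :+ z :* z :^ 2 :+ z :* z :+ z) refl a
      den≈1 : tangentDen 0# 0# ≈ 1#
      den≈1 = solve 1 (λ a → con (pos 2) :* z :+ a :* z :+ con (pos 1) := con (pos 1)) refl a
      flex : Flex 0# 0# 0#
      flex =
          solve 1 (λ a → z :* (con (pos 2) :* z :+ a :* z :+ con (pos 1))
            := con (pos 3) :* z :^ 2 :+ con (pos 2) :* z :* z :+ z :- a :* z) refl a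
        , solve 1 (λ a → z :^ 2 :+ a :* z :- z :- z :- z := z) refl a

theorem2 : ∀ {c ℓ} (F : FiniteField c ℓ) →
  let open FiniteField F
      open IntegerSolver commutativeRing using (fromℕ)
      open EllipticCurves F
      open EllipticCurve using (curve)
  in
  3 ∣ order ℕ.+ 1 →
  ((E : EllipticCurve) → HasRationalPointOfOrder E 3 →
    (∃[ a ] a ≉ fromℕ 3 × curve E ≅ family a) × HasCyclicTorsion E 3)
  ×
  ((a : Carrier) → a ≉ fromℕ 3 →
    Σ[ Δ≉0 ∈ WeierstrassCurve.Δ (family a) ≉ 0# ]
      HasCyclicTorsion (elliptic (family a) Δ≉0) 3)
theorem2 F 3∣q+1 =
  let k , order≡ = order-form 3∣q+1
  in normalForm k order≡ , family-cyclicTorsion k order≡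
  where
  open FiniteFieldProperties F
  open WeierstrassProperties F
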